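{- Let $F$ be an infinitary formula over $\sigma$ and let $\mathcal{P}_1,\mathcal{P}_2\subseteq\sigma$ be sets of atoms such that $\{\mathcal{P}_1,\mathcal{P}_2\}$ is a partition of $\mathcal{P}_1\cup\mathcal{P}_2$ that is infinitely separable on the positive dependency graph $\mathrm{DG}_{\mathcal{P}_1\cup\mathcal{P}_2}[F]$. Then, for any interpretation $I$ of $\sigma$, $I$ is a $(\mathcal{P}_1\cup\mathcal{P}_2)$-stable model of $F$ if and only if $I$ is both a $\mathcal{P}_1$-stable model of $F$ and a $\mathcal{P}_2$-stable model of $F$.
   Context: Let $\sigma$ be a propositional signature (a set of atoms). Infinitary formulas over $\sigma$ of rank $r$ ($r$ a nonnegative integer) are defined recursively: every atom is a formula of rank $0$; if $\mathcal{H}$ is a set of formulas and $r$ is the smallest nonnegative integer greater than the ranks of all elements of $\mathcal{H}$, then $\mathcal{H}^\land$ and $\mathcal{H}^\lor$ are formulas of rank $r$; if $F,G$ are formulas and $r$ is the smallest nonnegative integer greater than the ranks of $F$ and $G$, then $F\rightarrow G$ is a formula of rank $r$. Abbreviations: $F\land G=\{F,G\}^\land$, $F\lor G=\{F,G\}^\lor$, $\top=\emptyset^\land$, $\bot=\emptyset^\lor$, $\neg F=F\rightarrow\bot$. An interpretation is a subset $I\subseteq\sigma$. Satisfaction: $I\models p$ iff $p\in I$; $I\models\mathcal{H}^\land$ iff $I\models F$ for all $F\in\mathcal{H}$; $I\models\mathcal{H}^\lor$ iff $I\models F$ for some $F\in\mathcal{H}$; $I\models F\rightarrow G$ iff $I\not\models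 F$ or $I\models G$. The reduct $F^I$: $p^I$ is $p$ if $p\in I$ and $\bot$ otherwise; $(\mathcal{H}^\land)^I=\{G^I: G\in\mathcal{H}\}^\land$; $(\mathcal{H}^\lor)^I=\{G^I: G\in\mathcal{H}\}^\lor$; $(G\rightarrow H)^I$ is $G^I\rightarrow H^I$ if $I\models G\rightarrow H$, and $\bot$ otherwise. For $\mathcal{A}\subseteq\sigma$ and $I,J\subseteq\sigma$, write $I\leq_{\mathcal{A}}J$ if $I\subseteq J$ and $J\setminus I\subseteq\mathcal{A}$. $I$ is an $\mathcal{A}$-stable model of $F$ if $I$ is a minimal model of $F^I$ with respect to $\leq_{\mathcal{A}}$ (i.e. $I\models F^I$ and no $J\neq I$ with $J\leq_{\mathcal{A}}I$ satisfies $F^I$). Strictly positive atoms: $\mathrm{P}(p)=\{p\}$; $\mathrm{P}(\mathcal{H}^\land)=\mathrm{P}(\mathcal{H}^\lor)=\bigcup_{H\in\mathcal{H}}\mathrm{P}(H)$; $\mathrm{P}(G\rightarrow H)=\mathrm{P}(H)$. Positive nonnegated atoms $\mathrm{Pnn}$ and negative nonnegated atoms $\mathrm{Nnn}$: $\mathrm{Pnn}(p)=\{p\}$, $\mathrm{Nnn}(p)=\emptyset$; for $\mathcal{H}^\land$ and $\mathcal{H}^\lor$ take the union over $H\in\mathcal{H}$ of $\mathrm{Pnn}(H)$, respectively $\mathrm{Nnn}(H)$; if $H$ is $\bot$ then $\mathrm{Pnn}(G\rightarrow H)=\mathrm{Nnn}(G\rightarrow H)=\emptyset$; otherwise $\mathrm{Pnn}(G\rightarrow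 H)=\mathrm{Nnn}(G)\cup\mathrm{Pnn}(H)$ and $\mathrm{Nnn}(G\rightarrow H)=\mathrm{Pnn}(G)\cup\mathrm{Nnn}(H)$. Rules: an atom has no rules; the rules of $G\rightarrow H$ are $G\rightarrow H$ and all rules of $H$; the rules of $\mathcal{H}^\land$ and $\mathcal{H}^\lor$ are the rules of all formulas in $\mathcal{H}$. The (positive) dependency graph $\mathrm{DG}_{\mathcal{A}}[F]$ is the directed graph with vertex set $\mathcal{A}$ that has an edge from $p$ to $q$ if for some rule $G\rightarrow H$ of $F$, $p\in\mathrm{P}(H)$ and $q\in\mathrm{Pnn}(G)$. A partition of a set is a set of disjoint, possibly empty, subsets that cover it. An infinite walk of a directed graph is an infinite sequence $(v_1,v_2,\dots)$ of vertices such that each pair $v_i,v_{i+1}$ is an edge from $v_i$ to $v_{i+1}$. A partition $\{\mathcal{P}_1,\mathcal{P}_2\}$ of the vertices of a directed graph is infinitely separable on it if for every infinite walk $(v_1,v_2,\dots)$, either $\{i: v_i\in\mathcal{P}_1\}$ or $\{i: v_i\in\mathcal{P}_2\}$ is finite. -}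

module Defs where

open import Axiom.ExcludedMiddle using (ExcludedMiddle)
open import Data.Empty.Polymorphic using (⊥)
open import Data.List.Base using (List)
open import Data.List.Membership.Propositional using () renaming (_∈_ to _∈ₗ_)
open import Data.Nat.Base using (ℕ; suc; _≤_; _<_)
open import Data.Product.Base using (∃; ∃₂; _×_)
open import Data.Sum.Base using (_⊎_)
open import Level using (Level) renaming (suc to lsuc)
open import Relation.Binary.Core using (Rel)
open import Relation.Binary.PropositionalEquality.Core using (_≡_)
open import Relation.Nullary.Decidable.Core using (Dec; yes; no)
open import Relation.Nullary.Negation.Core using (¬_)
open import Relation.Unary using (Pred; _∈_; _⊆_; _≐_; _∪_; _∖_)
  renaming (_⊥_ to _Disjoint_)

private
  variable
    ℓ : Level
    σ : Set ℓ

infixr 6 _⟶_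
infix 4 _⊨_ _≤[_]_

-- A set 𝓗 of formulas is presented as a family indexed by an arbitrary type;
-- repetitions in the family affect none of the notions below.  The type also
-- contains trees of transfinite rank: an infinitary formula is an F such that
-- HasRank F r for some r : ℕ.

data Formula {ℓ} (σ : Set ℓ) : Set (lsuc ℓ) where
  atom : σ → Formula σ
  ⋀ ⋁  : (ι : Set ℓ) → (ι → Formula σ) → Formula σ
  _⟶_  : Formula σ → Formula σ → Formula σ

SmallestAbove : Pred ℕ ℓ → ℕ → Set ℓ
SmallestAbove S r = (S ⊆ (_< r)) × (∀ m → S ⊆ (_< m) → r ≤ m)

data HasRank {ℓ} {σ : Set ℓ} : Formula σ → ℕ → Set (lsuc ℓ) where
  atom : ∀ p → HasRank (atom p) 0
  ⋀    : ∀ {ι H r} (rank : ι → ℕ) → (∀ i → HasRank (H i) (rank i)) →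
         SmallestAbove (λ n → ∃ λ i → n ≡ rank i) r → HasRank (⋀ ι H) r
  ⋁    : ∀ {ι H r} (rank : ι → ℕ) → (∀ i → HasRank (H i) (rank i)) →
         SmallestAbove (λ n → ∃ λ i → n ≡ rank i) r → HasRank (⋁ ι H) r
  _⟶_  : ∀ {F G s t r} → HasRank F s → HasRank G t →
         SmallestAbove (λ n → n ≡ s ⊎ n ≡ t) r → HasRank (F ⟶ G) r

⊥ᶠ : Formula σ
⊥ᶠ = ⋁ ⊥ λ ()

-- "F is ⊥", i.e. F is 𝓗^∨ with 𝓗 the empty set, whichever empty type
-- indexes 𝓗.

Is⊥ᶠ : {σ : Set ℓ} → Formula σ → Set ℓ
Is⊥ᶠ (⋁ ι _) = ¬ ι
Is⊥ᶠ _       = ⊥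

_⊨_ : {σ : Set ℓ} → Pred σ ℓ → Formula σ → Set ℓ
I ⊨ atom p  = p ∈ I
I ⊨ ⋀ ι H   = ∀ i → I ⊨ H i
I ⊨ ⋁ ι H   = ∃ λ i → I ⊨ H i
I ⊨ (F ⟶ G) = ¬ (I ⊨ F) ⊎ (I ⊨ G)

if-dec_then_else_ : {P : Set ℓ} → Dec P → Formula σ → Formula σ → Formula σ
if-dec yes _ then F else G = F
if-dec no  _ then F else G = G

-- The case distinctions of the reduct are not decidable constructively, hence
-- the excluded middle argument.

reduct : {σ : Set ℓ} → ExcludedMiddle ℓ → Formula σ → Pred σ ℓ → Formula σ
reduct em (atom p) I = if-dec em {p ∈ I} then atom p else ⊥ᶠ
reduct em (⋀ ι H)  I = ⋀ ι λ i → reduct em (H i) I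
reduct em (⋁ ι H)  I = ⋁ ι λ i → reduct em (H i) I
reduct em (G ⟶ H)  I =
  if-dec em {I ⊨ (G ⟶ H)} then (reduct em G I ⟶ reduct em H I) else ⊥ᶠ

_≤[_]_ : {σ : Set ℓ} → Pred σ ℓ → Pred σ ℓ → Pred σ ℓ → Set ℓ
I ≤[ 𝓐 ] J = (I ⊆ J) × ((J ∖ I) ⊆ 𝓐)

Stable : {σ : Set ℓ} → ExcludedMiddle ℓ →
         (𝓐 : Pred σ ℓ) → Formula σ → Pred σ ℓ → Set (lsuc ℓ)
Stable em 𝓐 F I =
  (I ⊨ reduct em F I) ×
  (∀ J → ¬ (J ≐ I) → J ≤[ 𝓐 ] I → ¬ (J ⊨ reduct em F I))

P : {σ : Set ℓ} → Formula σ → Pred σ ℓ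
P (atom p) q = q ≡ p
P (⋀ ι H)  q = ∃ λ i → q ∈ P (H i)
P (⋁ ι H)  q = ∃ λ i → q ∈ P (H i)
P (G ⟶ H)  q = q ∈ P H

mutual
  Pnn : {σ : Set ℓ} → Formula σ → Pred σ ℓ
  Pnn (atom p) q = q ≡ p
  Pnn (⋀ ι H)  q = ∃ λ i → q ∈ Pnn (H i)
  Pnn (⋁ ι H)  q = ∃ λ i → q ∈ Pnn (H i)
  Pnn (G ⟶ H)  q = ¬ Is⊥ᶠ H × (q ∈ Nnn G ⊎ q ∈ Pnn H)

  Nnn : {σ : Set ℓ} → Formula σ → Pred σ ℓ
  Nnn (atom p) q = ⊥
  Nnn (⋀ ι H)  q = ∃ λ i → q ∈ Nnn (H i)
  Nnn (⋁ ι H)  q = ∃ λ i → q ∈ Nnn (H i)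
  Nnn (G ⟶ H)  q = ¬ Is⊥ᶠ H × (q ∈ Pnn G ⊎ q ∈ Nnn H)

-- Rule F G H: the implication G ⟶ H is a rule of F.

data Rule {ℓ} {σ : Set ℓ} : Formula σ → Formula σ → Formula σ → Set (lsuc ℓ) where
  here  : ∀ {G H} → Rule (G ⟶ H) G H
  there : ∀ {G H G′ H′} → Rule H G′ H′ → Rule (G ⟶ H) G′ H′
  in-⋀  : ∀ {ι 𝓗 G H} (i : ι) → Rule (𝓗 i) G H → Rule (⋀ ι 𝓗) G H
  in-⋁  : ∀ {ι 𝓗 G H} (i : ι) → Rule (𝓗 i) G H → Rule (⋁ ι 𝓗) G H

-- Only pairs of elements of vertices count as edges; see InfiniteWalk.

record Digraph {ℓ} (V : Set ℓ) : Set (lsuc (lsuc ℓ)) where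
  field
    vertices : Pred V ℓ
    edge     : Rel V (lsuc ℓ)

open Digraph public

DG[_] : {σ : Set ℓ} → Pred σ ℓ → Formula σ → Digraph σ
DG[ 𝓐 ] F .vertices = 𝓐
DG[ 𝓐 ] F .edge p q = ∃₂ λ G H → Rule F G H × p ∈ P H × q ∈ Pnn G

IsPartition : {V : Set ℓ} → Pred V ℓ → Pred V ℓ → Pred V ℓ → Set ℓ
IsPartition 𝓟₁ 𝓟₂ 𝓐 = (𝓟₁ Disjoint 𝓟₂) × ((𝓟₁ ∪ 𝓟₂) ≐ 𝓐)

InfiniteWalk : {V : Set ℓ} → Digraph V → (ℕ → V) → Set (lsuc ℓ)
InfiniteWalk Γ v = ∀ i → (v i ∈ vertices Γ) × edge Γ (v i) (v (suc i))

Finite : Pred ℕ ℓ → Set ℓ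
Finite S = ∃ λ (xs : List ℕ) → S ⊆ (_∈ₗ xs)

InfinitelySeparable : {V : Set ℓ} → Digraph V → Pred V ℓ → Pred V ℓ → Set (lsuc ℓ)
InfinitelySeparable Γ 𝓟₁ 𝓟₂ =
  ∀ v → InfiniteWalk Γ v →
  Finite (λ i → v i ∈ 𝓟₁) ⊎ Finite (λ i → v i ∈ 𝓟₂)

{-# OPTIONS --safe #-}
module Submission where

-- For J ⊆ I with J ⊨ Fᴵ, put X = I ∖ J.  If Z ⊆ X has no edges into X ∖ Z, then
-- I ∖ Z ⊨ Fᴵ as well.  Apply this to the sets Z of vertices reachable inside X
-- from some v ∈ X: if I is both 𝓟₁-stable and 𝓟₂-stable, none of them is
-- contained in 𝓟₁ or in 𝓟₂, so that every vertex of X reaches both 𝓟₁ and 𝓟₂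
-- inside X.  Going back and forth between the two yields an infinite walk that
-- visits both infinitely often, contrary to infinite separability.

open import Defs
open import Axiom.ExcludedMiddle using (ExcludedMiddle)
open import Data.Bool.Base using (Bool; true; false; not)
open import Data.Bool.Properties using (_≟_; ¬-not)
open import Data.List.Extrema.Nat using (max; xs≤max)
open import Data.List.Relation.Unary.All using (lookup)
open import Data.Nat.Base using (ℕ; zero; suc; _+_; _≤_)
open import Data.Nat.Properties using (m≤m+n; ≤-trans; 1+n≰n)
open import Data.Product.Base using (Σ; ∃; _×_; _,_; proj₁; proj₂)
open import Data.Sum.Base using (_⊎_; inj₁; inj₂; [_,_]′)
open import Function.Base using (_∘_)
open import Function.Bundles using (_⇔_; mk⇔)
open import Level using (Level; Lift; lift; _⊔_)
open import Relation.Binary.Construct.Closure.ReflexiveTransitive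
  using (Star; ε; _◅_; _◅◅_)
open import Relation.Binary.Core using (Rel)
open import Relation.Binary.PropositionalEquality.Core
  using (_≡_; refl; sym; trans; subst)
open import Relation.Nullary.Decidable
  using (Dec; yes; no; True; toWitness; fromWitness; decidable-stable)
open import Relation.Nullary.Negation using (¬_; contradiction)
open import Relation.Unary using (Pred; _∈_; _∉_; _⊆_; _∩_; _∪_; _∖_)

private
  variable
    ℓ : Level

-- Infinite walks that alternate between two sets.

module Alternate {a r c} {V : Set a} (_⇝_ : Rel V r) (C : Bool → Pred V c)
  (disjoint : ∀ {b v} → v ∈ C b → v ∉ C (not b))
  (reach : ∀ v b → ∃ λ w → w ∈ C b × Star _⇝_ v w) where

  -- `path` is what remains to be walked towards the current target set `C goal`; carrying it along
  -- turns the walk into plain iteration of a step function.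
  record State : Set (a ⊔ r ⊔ c) where
    constructor state
    field
      pos     : V
      goal    : Bool
      {end}   : V
      end∈C   : end ∈ C goal
      path    : Star _⇝_ pos end

  open State

  advance : ∀ s → Σ State λ s′ → pos s ⇝ pos s′
  advance (state v b w∈C (e ◅ es)) = state _ b w∈C es , e
  advance (state v b v∈C ε) with reach v (not b)
  -- An empty path would put `v` in both sets, so even a change of goal costs a genuine edge.
  ... | _ , v∈C′ , ε      = contradiction v∈C′ (disjoint v∈C)
  ... | _ , w∈C , e ◅ es = state _ (not b) w∈C es , e

  next : State → State
  next = proj₁ ∘ advance

  run : State → ℕ → State
  run s zero    = s
  run s (suc i) = run (next s) i

  run-+ : ∀ s i j → run (run s i) j ≡ run s (i + j)
  run-+ s zero    j = refl
  run-+ s (suc i) j = run-+ (next s) i j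

  run-edge : ∀ s i → pos (run s i) ⇝ pos (run s (suc i))
  run-edge s zero    = proj₂ (advance s)
  run-edge s (suc i) = run-edge (next s) i

  goal-next-ε : ∀ {v b} (v∈C : v ∈ C b) → goal (next (state v b v∈C ε)) ≡ not b
  goal-next-ε {v} {b} v∈C with reach v (not b)
  ... | _ , v∈C′ , ε    = contradiction v∈C′ (disjoint v∈C)
  ... | _ , _ , _ ◅ _ = refl

  -- The walk follows the stored path verbatim, so `j` is its length; the goal flips only in the
  -- step that leaves its end, hence `suc j`.
  arrive : ∀ {v b w} (w∈C : w ∈ C b) (es : Star _⇝_ v w) →
           let s = state v b w∈C es in
           ∃ λ j → pos (run s j) ∈ C b × goal (run s (suc j)) ≡ not b
  arrive w∈C ε        = 0 , w∈C , goal-next-ε w∈C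
  arrive w∈C (_ ◅ es) = let j , hit , turn = arrive w∈C es in suc j , hit , turn

  visit : ∀ s b → ∃ λ j → pos (run s j) ∈ C b
  visit s b with arrive (end∈C s) (path s) | goal s ≟ b
  ... | j , hit , _    | yes refl = j , hit
  -- The current goal is the other set: reach it first, after which the goal is `b`, then arrive a
  -- second time.
  ... | j , _   , turn | no  g≢b
    with k , hit , _ ← arrive (end∈C (run s (suc j))) (path (run s (suc j))) =
    suc j + k ,
    subst (λ t → pos t ∈ C b) (run-+ s (suc j) k)
      (subst (λ g → pos (run (run s (suc j)) k) ∈ C g)
        (trans turn (sym (¬-not (g≢b ∘ sym)))) hit)

  visit-after : ∀ s b n → ∃ λ j → n ≤ j × pos (run s j) ∈ C b
  visit-after s b n with j , hit ← visit (run s n) b =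
    n + j , m≤m+n n j , subst (λ t → pos t ∈ C b) (run-+ s n j) hit

unbounded⇒infinite : {S : Pred ℕ ℓ} → (∀ n → ∃ λ j → n ≤ j × j ∈ S) → ¬ Finite S
unbounded⇒infinite unbounded (xs , S⊆xs)
  with j , m<j , j∈S ← unbounded (suc (max 0 xs)) =
  1+n≰n (≤-trans m<j (lookup (xs≤max 0 xs) (S⊆xs j∈S)))

-- Satisfaction of the reduct by different interpretations.

module _ {σ : Set ℓ} {J : Pred σ ℓ} {Q : Set ℓ} {F : Formula σ} where

  ⊨-if⁺ : (d : Dec Q) → Q → J ⊨ F → J ⊨ (if-dec d then F else ⊥ᶠ)
  ⊨-if⁺ (yes _) _ J⊨F = J⊨F
  ⊨-if⁺ (no ¬q) q _   = contradiction q ¬q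

  ⊨-if⁻ : (d : Dec Q) → J ⊨ (if-dec d then F else ⊥ᶠ) → Q × J ⊨ F
  ⊨-if⁻ (yes q) J⊨F = q , J⊨F
  ⊨-if⁻ (no _)  (lift () , _)

Is⊥ᶠ⇒⊭ : {σ : Set ℓ} {I : Pred σ ℓ} (F : Formula σ) → Is⊥ᶠ F → ¬ (I ⊨ F)
Is⊥ᶠ⇒⊭ (⋁ ι H) ¬ι (i , _) = ¬ι i

module Reduct (em : ∀ {a} → ExcludedMiddle a) {ℓ} {σ : Set ℓ} (I : Pred σ ℓ) where

  infix 4 _⊨ᴵ_
  _⊨ᴵ_ : Pred σ ℓ → Formula σ → Set ℓ
  J ⊨ᴵ F = J ⊨ reduct em F I

  module _ {J : Pred σ ℓ} where

    ⟶⁺ : ∀ {G H} → I ⊨ (G ⟶ H) → (J ⊨ᴵ G → J ⊨ᴵ H) → J ⊨ᴵ (G ⟶ H)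
    ⟶⁺ {G} {H} I⊨ f = ⊨-if⁺ em I⊨ (material em)
      where
      material : Dec (J ⊨ᴵ G) → ¬ (J ⊨ᴵ G) ⊎ (J ⊨ᴵ H)
      material (yes g) = inj₂ (f g)
      material (no ¬g) = inj₁ ¬g

    ⟶⁻ : ∀ {G H} → J ⊨ᴵ (G ⟶ H) → I ⊨ (G ⟶ H) × (J ⊨ᴵ G → J ⊨ᴵ H)
    ⟶⁻ J⊨ with ⊨-if⁻ em J⊨
    ... | I⊨ , inj₁ ¬g = I⊨ , λ g → contradiction g ¬g
    ... | I⊨ , inj₂ h  = I⊨ , λ _ → h

    -- An atom or implication refuted by `I` has reduct `⊥ᶠ`, which no `J` satisfies.
    ⊨ᴵ⇒⊨ : ∀ F → J ⊨ᴵ F → I ⊨ F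
    ⊨ᴵ⇒⊨ (atom p) J⊨       = proj₁ (⊨-if⁻ {F = atom p} em J⊨)
    ⊨ᴵ⇒⊨ (⋀ ι H)  J⊨       = λ i → ⊨ᴵ⇒⊨ (H i) (J⊨ i)
    ⊨ᴵ⇒⊨ (⋁ ι H)  (i , J⊨) = i , ⊨ᴵ⇒⊨ (H i) J⊨
    ⊨ᴵ⇒⊨ (G ⟶ H)  J⊨       = proj₁ (⟶⁻ {G} {H} J⊨)

    ⟶-⊨-head : ∀ {G H} → I ⊨ (G ⟶ H) → J ⊨ᴵ G → I ⊨ H
    ⟶-⊨-head {G} (inj₁ ¬g) g = contradiction (⊨ᴵ⇒⊨ G g) ¬g
    ⟶-⊨-head     (inj₂ h)  _ = h

    -- If `J` satisfies the reduct of an antecedent, then `I` satisfies the antecedent and hence the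
    -- consequent. The induction thus enters consequents only, and strictly positive atoms suffice.
    ⊨⇒⊨ᴵ : ∀ F → P F ∩ I ⊆ J → I ⊨ F → J ⊨ᴵ F
    ⊨⇒⊨ᴵ (atom p) P⊆ p∈I     = ⊨-if⁺ em p∈I (P⊆ (refl , p∈I))
    ⊨⇒⊨ᴵ (⋀ ι H)  P⊆ I⊨      =
      λ i → ⊨⇒⊨ᴵ (H i) (λ (p , q) → P⊆ ((i , p) , q)) (I⊨ i)
    ⊨⇒⊨ᴵ (⋁ ι H)  P⊆ (i , h) =
      i , ⊨⇒⊨ᴵ (H i) (λ (p , q) → P⊆ ((i , p) , q)) h
    ⊨⇒⊨ᴵ (G ⟶ H)  P⊆ I⊨      =
      ⟶⁺ {G} {H} I⊨ (⊨⇒⊨ᴵ H P⊆ ∘ ⟶-⊨-head {G} {H} I⊨)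

  -- If H is ⊥, then I refutes G, and hence so do J and K.
  ⟶-transfer : ∀ {J K} G H → J ⊨ᴵ (G ⟶ H) →
               (¬ Is⊥ᶠ H → K ⊨ᴵ G → J ⊨ᴵ G) → (¬ Is⊥ᶠ H → J ⊨ᴵ H → K ⊨ᴵ H) →
               K ⊨ᴵ (G ⟶ H)
  ⟶-transfer {J} {K} G H J⊨ body head with ⟶⁻ {G = G} {H} J⊨
  ... | I⊨ , f = ⟶⁺ {G = G} {H} I⊨ (λ g →
    let H≢⊥ = λ H≡⊥ → Is⊥ᶠ⇒⊭ H H≡⊥ (⟶-⊨-head {G = G} {H} I⊨ g)
    in head H≢⊥ (f (body H≢⊥ g)))

  module _ {J K : Pred σ ℓ} (J⊆K : J ⊆ K) where

    mutual
      -- Simultaneous induction with `grow`, since antecedents swap `Pnn` and `Nnn`. Implications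
      -- with consequent ⊥ contribute no atoms; `⟶-transfer` settles them and supplies `H≢⊥`
      -- otherwise.
      shrink : ∀ F → Pnn F ∩ K ⊆ J → K ⊨ᴵ F → J ⊨ᴵ F
      shrink (atom p) Pnn⊆ K⊨ with p∈I , p∈K ← ⊨-if⁻ {F = atom p} em K⊨ =
        ⊨-if⁺ em p∈I (Pnn⊆ (refl , p∈K))
      shrink (⋀ ι H) Pnn⊆ K⊨ =
        λ i → shrink (H i) (λ (p , q) → Pnn⊆ ((i , p) , q)) (K⊨ i)
      shrink (⋁ ι H) Pnn⊆ (i , K⊨) =
        i , shrink (H i) (λ (p , q) → Pnn⊆ ((i , p) , q)) K⊨
      shrink (G ⟶ H) Pnn⊆ K⊨ = ⟶-transfer G H K⊨
        (λ H≢⊥ → grow G (λ (p , q) → Pnn⊆ ((H≢⊥ , inj₁ p) , q)))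
        (λ H≢⊥ → shrink H (λ (p , q) → Pnn⊆ ((H≢⊥ , inj₂ p) , q)))

      grow : ∀ F → Nnn F ∩ K ⊆ J → J ⊨ᴵ F → K ⊨ᴵ F
      grow (atom p) _ J⊨ with p∈I , p∈J ← ⊨-if⁻ {F = atom p} em J⊨ =
        ⊨-if⁺ em p∈I (J⊆K p∈J)
      grow (⋀ ι H) Nnn⊆ J⊨ =
        λ i → grow (H i) (λ (p , q) → Nnn⊆ ((i , p) , q)) (J⊨ i)
      grow (⋁ ι H) Nnn⊆ (i , J⊨) =
        i , grow (H i) (λ (p , q) → Nnn⊆ ((i , p) , q)) J⊨
      grow (G ⟶ H) Nnn⊆ J⊨ = ⟶-transfer G H J⊨
        (λ H≢⊥ → shrink G (λ (p , q) → Nnn⊆ ((H≢⊥ , inj₁ p) , q)))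
        (λ H≢⊥ → grow H (λ (p , q) → Nnn⊆ ((H≢⊥ , inj₂ p) , q)))

    -- For each rule, either `K` keeps enough of `I` to satisfy the head outright, or the body is
    -- pulled back to `J` by `shrink`, the rule is applied there, and induction carries the head to
    -- `K`.
    ⊨ᴵ-enlarge : ∀ F →
                 (∀ {G H} → Rule F G H → (P H ∩ I ⊆ K) ⊎ (Pnn G ∩ K ⊆ J)) →
                 J ⊨ᴵ F → K ⊨ᴵ F
    ⊨ᴵ-enlarge (atom p) _ J⊨ with p∈I , p∈J ← ⊨-if⁻ {F = atom p} em J⊨ =
      ⊨-if⁺ em p∈I (J⊆K p∈J)
    ⊨ᴵ-enlarge (⋀ ι H) rules J⊨ = λ i → ⊨ᴵ-enlarge (H i) (rules ∘ in-⋀ i) (J⊨ i)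
    ⊨ᴵ-enlarge (⋁ ι H) rules (i , J⊨) = i , ⊨ᴵ-enlarge (H i) (rules ∘ in-⋁ i) J⊨
    ⊨ᴵ-enlarge (G ⟶ H) rules J⊨ with ⟶⁻ {G = G} {H} J⊨ | rules here
    ... | I⊨ , _ | inj₁ P⊆   =
      ⟶⁺ {G = G} {H} I⊨ (⊨⇒⊨ᴵ H P⊆ ∘ ⟶-⊨-head {G = G} {H} I⊨)
    ... | I⊨ , f | inj₂ Pnn⊆ =
      ⟶⁺ {G = G} {H} I⊨
        (⊨ᴵ-enlarge H (rules ∘ there) ∘ f ∘ shrink G Pnn⊆)

  module _ (F : Formula σ) {J Z : Pred σ ℓ}
    (J⊆I : J ⊆ I) (J∩Z≡∅ : ∀ {p} → p ∈ J → p ∉ Z)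
    (closed : ∀ {G H p q} → Rule F G H → p ∈ P H → q ∈ Pnn G →
              p ∈ Z → q ∈ I ∖ J → q ∈ Z)
    where

    ⊨ᴵ-∖-closed : J ⊨ᴵ F → (I ∖ Z) ⊨ᴵ F
    ⊨ᴵ-∖-closed = ⊨ᴵ-enlarge (λ p∈J → J⊆I p∈J , J∩Z≡∅ p∈J) F rules
      where
      rules : ∀ {G H} → Rule F G H →
              (P H ∩ I ⊆ I ∖ Z) ⊎ (Pnn G ∩ (I ∖ Z) ⊆ J)
      rules {G} {H} rule with em {P = ∃ λ p → p ∈ P H × p ∈ Z}
      ... | no  none            =
        inj₁ λ (p∈P , p∈I) → p∈I , λ p∈Z → none (_ , p∈P , p∈Z)
      -- By `closed`, the atoms of `Pnn G` in `I ∖ J` all lie in `Z`, so those that survive in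
      -- `I ∖ Z` belong to `J`.
      ... | yes (p , p∈P , p∈Z) =
        inj₂ λ (q∈Pnn , q∈I , q∉Z) → decidable-stable em λ q∉J →
          q∉Z (closed rule p∈P q∈Pnn p∈Z (q∈I , q∉J))

-- Stability and reachability inside `I ∖ J`.

Stable-antimono : (em : ExcludedMiddle ℓ) {σ : Set ℓ} {𝓐 𝓑 : Pred σ ℓ} →
                  𝓐 ⊆ 𝓑 → ∀ F {I} → Stable em 𝓑 F I → Stable em 𝓐 F I
Stable-antimono em 𝓐⊆𝓑 F (I⊨ , minimal) =
  I⊨ , λ J J≢I (J⊆I , I∖J⊆𝓐) → minimal J J≢I (J⊆I , λ p → 𝓐⊆𝓑 (I∖J⊆𝓐 p))

module Separable (em : ∀ {a} → ExcludedMiddle a) {ℓ} {σ : Set ℓ}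
  (F : Formula σ) (I J : Pred σ ℓ) (J⊆I : J ⊆ I)
  (J⊨ : J ⊨ reduct em F I)
  where

  X : Pred σ ℓ
  X = I ∖ J

  -- `edge` does not look at the vertex set; it is the type `∃ X` that confines paths to `X`.
  _⇝_ : Rel (∃ X) _
  (p , _) ⇝ (q , _) = edge (DG[ X ] F) p q

  Reachable : ∃ X → Pred σ _
  Reachable v w = Σ (w ∈ X) λ x → Star _⇝_ v (w , x)

  -- Reachability lives one universe above the interpretations; excluded middle
  -- brings it down.
  Reachable′ : ∃ X → Pred σ ℓ
  Reachable′ v w = Lift ℓ (True (em {P = Reachable v w}))

  lower-reachable : ∀ {v w} → Reachable v w → Reachable′ v w
  lower-reachable ρ = lift (fromWitness ρ)

  raise-reachable : ∀ {v w} → Reachable′ v w → Reachable v w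
  raise-reachable (lift ρ) = toWitness ρ

  -- Otherwise all that is reachable from `v` lies in `𝓐`. This set is closed under edges within
  -- `X`, so removing it from `I` leaves a model of the reduct, against minimality.
  reaches-outside : ∀ {𝓐} → Stable em 𝓐 F I → ∀ v →
                    ∃ λ w → proj₁ w ∉ 𝓐 × Star _⇝_ v w
  reaches-outside {𝓐} (_ , minimal) v@(p , p∈X) = decidable-stable em λ none →
    minimal (I ∖ Reachable′ v)
      -- The empty path makes `v` itself reachable, so the competitor differs from `I`.
      (λ (_ , I⊆) → proj₂ (I⊆ (proj₁ p∈X)) (lower-reachable (p∈X , ε)))
      (proj₁ , λ (w∈I , w∉) → decidable-stable em λ w∉𝓐 →
        w∉ (w∈I , λ z → none (_ , w∉𝓐 , proj₂ (raise-reachable {v} z))))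
      (Reduct.⊨ᴵ-∖-closed em I F J⊆I
        (λ w∈J z → proj₂ (proj₁ (raise-reachable {v} z)) w∈J)
        closed J⊨)
    where
    closed : ∀ {G H p q} → Rule F G H → p ∈ P H → q ∈ Pnn G →
             p ∈ Reachable′ v → q ∈ X → q ∈ Reachable′ v
    closed rule p∈P q∈Pnn z q∈X with x , path ← raise-reachable {v} z =
      lower-reachable (q∈X , path ◅◅ (_ , _ , rule , p∈P , q∈Pnn) ◅ ε)

mainTheorem1 : (em : ∀ {a : Level} → ExcludedMiddle a) →
    ∀ {ℓ : Level} {σ : Set ℓ} (F : Formula σ) (r : ℕ) → HasRank F r →
    (𝓟₁ 𝓟₂ : Pred σ ℓ) →
    IsPartition 𝓟₁ 𝓟₂ (𝓟₁ ∪ 𝓟₂) →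
    InfinitelySeparable (DG[ 𝓟₁ ∪ 𝓟₂ ] F) 𝓟₁ 𝓟₂ →
    (I : Pred σ ℓ) →
    Stable em (𝓟₁ ∪ 𝓟₂) F I ⇔ (Stable em 𝓟₁ F I × Stable em 𝓟₂ F I)
mainTheorem1 em F r _ 𝓟₁ 𝓟₂ (disjoint , _) separable I = mk⇔
  (λ stable → Stable-antimono em inj₁ F stable , Stable-antimono em inj₂ F stable)
  (λ (stable₁ , stable₂) → proj₁ stable₁ , λ J J≢I (J⊆I , X⊆𝓟) J⊨ →
    J≢I (J⊆I , λ p∈I → decidable-stable em λ p∉J →
      no-counterexample stable₁ stable₂ J J⊆I X⊆𝓟 J⊨ (_ , p∈I , p∉J)))
  where
  no-counterexample : Stable em 𝓟₁ F I → Stable em 𝓟₂ F I →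
                      ∀ J → J ⊆ I → I ∖ J ⊆ 𝓟₁ ∪ 𝓟₂ →
                      J ⊨ reduct em F I → ¬ ∃ (I ∖ J)
  no-counterexample stable₁ stable₂ J J⊆I X⊆𝓟 J⊨ start =
    [ unbounded⇒infinite (visit-after s true)
    , unbounded⇒infinite (visit-after s false) ]′
      (separable (proj₁ ∘ State.pos ∘ run s)
        -- Edges are the same for every vertex set, so only membership of the vertices in `𝓟₁ ∪ 𝓟₂`
        -- has to be added.
        (λ i → X⊆𝓟 (proj₂ (State.pos (run s i))) , run-edge s i))
    where
    open Separable em F I J J⊆I J⊨

    C : Bool → Pred (∃ X) _
    C true  (p , _) = p ∈ 𝓟₁
    C false (p , _) = p ∈ 𝓟₂

    reach : ∀ v b → ∃ λ w → w ∈ C b × Star _⇝_ v w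
    -- The roles cross: a vertex of `X` outside `𝓟₂` lies in `𝓟₁`, so stability for `𝓟₂` leads into
    -- `𝓟₁`.
    reach v true with w@(_ , w∈X) , w∉ , path ← reaches-outside stable₂ v =
      w , [ (λ w∈ → w∈) , (λ w∈ → contradiction w∈ w∉) ]′ (X⊆𝓟 w∈X) , path
    reach v false with w@(_ , w∈X) , w∉ , path ← reaches-outside stable₁ v =
      w , [ (λ w∈ → contradiction w∈ w∉) , (λ w∈ → w∈) ]′ (X⊆𝓟 w∈X) , path

    C-disjoint : ∀ {b v} → v ∈ C b → v ∉ C (not b)
    C-disjoint {true}  v∈₁ v∈₂ = disjoint (v∈₁ , v∈₂)
    C-disjoint {false} v∈₂ v∈₁ = disjoint (v∈₁ , v∈₂)

    open Alternate _⇝_ C (λ {b} {v} → C-disjoint {b} {v}) reach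

    s : State
    s = let _ , w∈C , path = reach start true in state start true w∈C path
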